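{- For every integer $n\ge 3$, $\Delta_n>0$; that is, Bob is strictly more likely than Alice to win the game with $n$ flips. Equivalently, the coefficient of $t^n$ in $f(t)=\frac12\big((1-t)(1-2t)(2t^2+t+1)\big)^{ -1/2}-\frac12(1-t)^{ -1}$ is strictly positive for all $n\ge3$.
   Context: A fair coin is flipped $n$ times, producing a sequence $x_1,\dots,x_n\in\{H,T\}$ of independent uniformly random outcomes. Alice's score is the number of indices $i\in\{1,\dots,n-1\}$ with $(x_i,x_{i+1})=(H,H)$; Bob's score is the number of indices $i\in\{1,\dots,n-1\}$ with $(x_i,x_{i+1})=(H,T)$. Let $P_n(\mathrm{Bob})$ be the probability that Bob's score is strictly larger than Alice's, $P_n(\mathrm{Alice})$ the probability that Alice's score is strictly larger than Bob's, and $\Delta_n=P_n(\mathrm{Bob})-P_n(\mathrm{Alice})$. The square root is the branch equal to $1$ at $t=0$. -}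

module Defs where

open import Data.Fin using (Fin; zero; suc; toℕ; opposite; inject₁; fromℕ)
open import Data.Fin.Properties using (toℕ<n; toℕ-inject₁; toℕ-fromℕ; opposite-prop)
open import Data.Integer using (+_)
open import Data.List using (List; []; _∷_; [_]; cartesianProductWith; filter; length)
open import Data.List.Membership.Propositional using (_∈_)
open import Data.List.Membership.Propositional.Properties using (∈-cartesianProductWith⁺)
open import Data.List.Relation.Unary.All using ([]; _∷_)
open import Data.List.Relation.Unary.AllPairs using ([]; _∷_)
open import Data.List.Relation.Unary.Any using (here; there)
open import Data.List.Relation.Unary.Unique.Propositional using (Unique)
open import Data.List.Relation.Unary.Unique.Propositional.Properties using (cartesianProductWith⁺)
open import Data.Nat as ℕ using (ℕ; zero; suc; pred; _∸_; _^_)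
import Data.Nat.Properties as ℕₚ
open import Data.Product using (_×_; _,_)
open import Data.Product.Properties using (≡-dec)
open import Data.Rational using (ℚ; 0ℚ; 1ℚ; ½; _/_; _+_; _*_; _-_; -_)
import Data.Rational.Properties as ℚₚ
open import Data.Rational.Solver using (module +-*-Solver)
open import Data.Vec using (Vec; []; _∷_; count; head; lookup)
open import Data.Vec.Properties using (∷-injective)
open import Relation.Binary.Definitions using (DecidableEquality)
open import Relation.Binary.PropositionalEquality using (_≡_; _≗_; refl; sym; trans; cong; cong₂; module ≡-Reasoning)
open import Relation.Nullary using (yes; no)
open import Relation.Unary using (Pred; Decidable)
open import Level using (0ℓ)

open import Algebra.Properties.CommutativeMonoid.Sum ℚₚ.+-0-commutativeMonoid public
  using (sum; sum-cong-≗; sum-init-last)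

data Coin : Set where
  H T : Coin

_≟_ : DecidableEquality Coin
H ≟ H = yes refl
H ≟ T = no λ ()
T ≟ H = no λ ()
T ≟ T = yes refl

outcomes : ∀ n → List (Vec Coin n)
outcomes zero    = [ [] ]
outcomes (suc n) = cartesianProductWith _∷_ (H ∷ T ∷ []) (outcomes n)

∈-outcomes : ∀ {n} (x : Vec Coin n) → x ∈ outcomes n
∈-outcomes []      = here refl
∈-outcomes (c ∷ x) = ∈-cartesianProductWith⁺ _∷_ (∈-coins c) (∈-outcomes x)
  where
  ∈-coins : ∀ c → c ∈ H ∷ T ∷ []
  ∈-coins H = here refl
  ∈-coins T = there (here refl)

outcomes-unique : ∀ n → Unique (outcomes n)
outcomes-unique zero    = [] ∷ []
outcomes-unique (suc n) =
  cartesianProductWith⁺ _∷_ ∷-injective (((λ ()) ∷ []) ∷ [] ∷ []) (outcomes-unique n)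

-- Independent fair flips: each of the 2 ^ n sequences has probability 1 / 2 ^ n.
Pr : ∀ n {P : Pred (Vec Coin n) 0ℓ} → Decidable P → ℚ
Pr n P? = (+ length (filter P? (outcomes n)) / (2 ^ n)) {{ℕₚ.m^n≢0 2 n}}

adjacentPairs : ∀ {A : Set} {n} → Vec A n → Vec (A × A) (pred n)
adjacentPairs []           = []
adjacentPairs (x ∷ [])     = []
adjacentPairs (x ∷ y ∷ xs) = (x , y) ∷ adjacentPairs (y ∷ xs)

occurrences : ∀ {n} → Coin × Coin → Vec Coin n → ℕ
occurrences ab x = count (≡-dec _≟_ _≟_ ab) (adjacentPairs x)

aliceScore bobScore : ∀ {n} → Vec Coin n → ℕ
aliceScore = occurrences (H , H)
bobScore   = occurrences (H , T)

P-Bob P-Alice Δ : ℕ → ℚ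
P-Bob   n = Pr n (λ x → aliceScore x ℕ.<? bobScore x)
P-Alice n = Pr n (λ x → bobScore x ℕ.<? aliceScore x)
Δ n = P-Bob n - P-Alice n

PowerSeries : Set
PowerSeries = ℕ → ℚ

coeff : ℕ → PowerSeries → ℚ
coeff n p = p n

infixl 6 _⊕_ _⊖_
infixl 7 _⊛_

_⊕_ _⊖_ _⊛_ : PowerSeries → PowerSeries → PowerSeries
(p ⊕ q) n = p n + q n
(p ⊖ q) n = p n - q n
(p ⊛ q) n = sum {suc n} (λ k → p (toℕ k) * q (n ∸ toℕ k))

const : ℚ → PowerSeries
const c zero    = c
const c (suc _) = 0ℚ

t : PowerSeries
t 1 = 1ℚ
t _ = 0ℚ

-- invCoeffs p n lists the coefficients n , … , 1 , 0 (in this order) of 1/p, where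
-- p has constant term 1:  i₀ = 1,  iₙ₊₁ = - ∑_{k=0}^{n} pₖ₊₁ iₙ₋ₖ.
invCoeffs : PowerSeries → ∀ n → Vec ℚ (suc n)
invCoeffs p zero    = 1ℚ ∷ []
invCoeffs p (suc n) = - sum (λ k → p (suc (toℕ k)) * lookup is k) ∷ is
  where is = invCoeffs p n

-- Only meaningful when p has constant term 1; see inv-inverse.
inv : PowerSeries → PowerSeries
inv p n = head (invCoeffs p n)

-- sqrtCoeffs p n lists the coefficients n , … , 1 (in this order) of the square root
-- with constant term 1 of p, where p has constant term 1:
-- sₙ₊₁ = ½ (pₙ₊₁ - ∑_{k=1}^{n} sₖ sₙ₊₁₋ₖ).
sqrtCoeffs : PowerSeries → ∀ n → Vec ℚ n
sqrtCoeffs p zero    = []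
sqrtCoeffs p (suc n) =
  ½ * (p (suc n) - sum (λ k → lookup ss (opposite k) * lookup ss k)) ∷ ss
  where ss = sqrtCoeffs p n

-- Only meaningful when p has constant term 1; see sqrt-square.
sqrt : PowerSeries → PowerSeries
sqrt p zero    = 1ℚ
sqrt p (suc n) = head (sqrtCoeffs p (suc n))

lookup-invCoeffs : ∀ p n k → lookup (invCoeffs p n) k ≡ inv p (n ∸ toℕ k)
lookup-invCoeffs p zero    zero    = refl
lookup-invCoeffs p (suc n) zero    = refl
lookup-invCoeffs p (suc n) (suc k) = lookup-invCoeffs p n k

inv-inverse : ∀ p → p 0 ≡ 1ℚ → p ⊛ inv p ≗ const 1ℚ
inv-inverse p p₀ zero = cong (λ c → c * 1ℚ + 0ℚ) p₀
inv-inverse p p₀ (suc n) = begin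
  p 0 * (- sum (λ k → p (suc (toℕ k)) * lookup (invCoeffs p n) k)) + S
    ≡⟨ cong₂ (λ c s → c * (- s) + S) p₀
         (sum-cong-≗ λ k → cong (p (suc (toℕ k)) *_) (lookup-invCoeffs p n k)) ⟩
  1ℚ * (- S) + S
    ≡⟨ cong (_+ S) (ℚₚ.*-identityˡ (- S)) ⟩
  - S + S
    ≡⟨ ℚₚ.+-inverseˡ S ⟩
  0ℚ ∎
  where
  open ≡-Reasoning
  S = sum {suc n} (λ k → p (suc (toℕ k)) * inv p (n ∸ toℕ k))

lookup-sqrtCoeffs : ∀ p n k → lookup (sqrtCoeffs p n) k ≡ sqrt p (n ∸ toℕ k)
lookup-sqrtCoeffs p (suc n) zero    = refl
lookup-sqrtCoeffs p (suc n) (suc k) = lookup-sqrtCoeffs p n k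

lookup-sqrtCoeffs-opposite : ∀ p n k →
  lookup (sqrtCoeffs p n) (opposite k) ≡ sqrt p (suc (toℕ k))
lookup-sqrtCoeffs-opposite p n k =
  trans (lookup-sqrtCoeffs p n (opposite k))
        (cong (sqrt p) (trans (cong (n ∸_) (opposite-prop k)) (ℕₚ.m∸[m∸n]≡n (toℕ<n k))))

sqrt-square : ∀ p → p 0 ≡ 1ℚ → sqrt p ⊛ sqrt p ≗ p
sqrt-square p p₀ zero    = sym p₀
sqrt-square p p₀ (suc n) = begin
  1ℚ * s + sum g
    ≡⟨ cong (λ a → 1ℚ * s + a) (sum-init-last g) ⟩
  1ℚ * s + (sum (λ k → g (inject₁ k)) + g (fromℕ n))
    ≡⟨ cong₂ (λ a b → 1ℚ * s + (a + b)) (sum-cong-≗ inner) outer ⟩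
  1ℚ * s + (S + s * 1ℚ)
    ≡⟨ solve 2 (λ x y → con 1ℚ :* (con ½ :* (x :- y)) :+ (y :+ con ½ :* (x :- y) :* con 1ℚ) := x)
         refl (p (suc n)) S ⟩
  p (suc n) ∎
  where
  open ≡-Reasoning
  open +-*-Solver
  s = sqrt p (suc n)
  ss = sqrtCoeffs p n
  S = sum (λ k → lookup ss (opposite k) * lookup ss k)
  g : Fin (suc n) → ℚ
  g k = sqrt p (suc (toℕ k)) * sqrt p (n ∸ toℕ k)
  inner : ∀ k → g (inject₁ k) ≡ lookup ss (opposite k) * lookup ss k
  inner k rewrite toℕ-inject₁ k =
    sym (cong₂ _*_ (lookup-sqrtCoeffs-opposite p n k) (lookup-sqrtCoeffs p n k))
  outer : g (fromℕ n) ≡ s * 1ℚ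
  outer rewrite toℕ-fromℕ n | ℕₚ.n∸n≡0 n = refl

radicand : PowerSeries
radicand = (const 1ℚ ⊖ t) ⊛ (const 1ℚ ⊖ const (+ 2 / 1) ⊛ t)
             ⊛ (const (+ 2 / 1) ⊛ (t ⊛ t) ⊕ t ⊕ const 1ℚ)

f : PowerSeries
f = const ½ ⊛ inv (sqrt radicand) ⊖ const ½ ⊛ inv (const 1ℚ ⊖ t)

radicand₀ : radicand 0 ≡ 1ℚ
radicand₀ = refl

{-# OPTIONS --safe #-}

-- In a sequence H x that ends in H, the part x splits into blocks H (a point for Alice)
-- and T…TH (a point for Bob).  The number of ways to choose block lengths ignores the order
-- of the blocks, so interchanging the two kinds relates the sequences of this form that Bob
-- wins by one point to those that Alice wins by one point.  This expresses the sum of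
-- sgn (Bob's score - Alice's score) over these sequences by the number of ties, and then
-- shows that among all sequences H x of length n + 1, Bob's wins exceed Alice's by
-- exactly the number of those that end in H and are won by Bob by one point.  A leading
-- T is irrelevant, so 2ⁿ Δ n is nondecreasing in n; it is 1 at n = 3.
--
-- The radicand is a polynomial of degree 4 and the coefficients of t, …, t⁴ in its
-- square root s are -1, 0, -2, 0; the recurrence for the square root then makes all later
-- coefficients nonpositive.  Hence the coefficients of 1/s are nondecreasing and, from t³ on,
-- at least 3, whereas those of 1/(1-t) are 1.
module Submission where

open import Defs
open import Data.Nat using (ℕ; _≥_)
open import Data.Product using (_×_; _,_)
open import Data.Rational using (0ℚ; _>_)
open import Data.Nat using (zero; suc; z≤n; s≤s; _∸_; _^_; NonZero)
import Data.Nat as ℕ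
import Data.Nat.Properties as ℕₚ
import Data.Integer.Base as ℤ
import Data.Integer.Properties as ℤₚ
import Data.Rational.Unnormalised as ℚᵘ
import Data.Rational.Unnormalised.Properties as ℚᵘₚ
open import Relation.Binary.PropositionalEquality using (_≡_; refl; sym; trans; cong; cong₂; subst; subst₂; module ≡-Reasoning)

-- Positivity of the coefficients of `f`.

module Series where

  open import Data.Fin using (Fin; zero; suc; toℕ; opposite)
  open import Data.Rational using (ℚ; 1ℚ; ½; _+_; _*_; _-_; -_; _/_; _≤_; _<_; _≤?_; _<?_; nonNegative; nonPositive)
  open import Data.Rational.Properties
  open import Algebra.Properties.Group +-0-group using (⁻¹-involutive)
  open import Data.Vec using ([]; _∷_; lookup)
  open import Function using (_∘_)
  open import Relation.Nullary using (yes; no)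
  open import Relation.Nullary.Decidable using (from-yes)

  -- `_/_` reduces to lowest terms, so the comparison is made between the unreduced fractions, which
  -- share a denominator.
  /-mono-< : ∀ {p q} d .{{_ : NonZero d}} → p ℤ.< q → p / d < q / d
  /-mono-< {p} {q} (suc d) p<q = toℚᵘ-cancel-<
    (ℚᵘₚ.<-respˡ-≃ (ℚᵘₚ.≃-sym (toℚᵘ-fromℚᵘ (ℚᵘ.mkℚᵘ p d)))
      (ℚᵘₚ.<-respʳ-≃ (ℚᵘₚ.≃-sym (toℚᵘ-fromℚᵘ (ℚᵘ.mkℚᵘ q d)))
        (ℚᵘ.*<* (ℤₚ.*-monoʳ-<-pos (ℤ.+ suc d) p<q))))

  p<q⇒0<q-p : ∀ {p q} → p < q → 0ℚ < q - p
  p<q⇒0<q-p {p} {q} p<q = subst (_< q - p) (+-inverseʳ p) (+-monoˡ-< (- p) p<q)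

  sum-zero : ∀ {n} {g : Fin n → ℚ} → (∀ k → g k ≡ 0ℚ) → sum g ≡ 0ℚ
  sum-zero {zero}  e = refl
  sum-zero {suc n} e = cong₂ _+_ (e zero) (sum-zero (e ∘ suc))

  sum-nonNeg : ∀ {n} {g : Fin n → ℚ} → (∀ k → 0ℚ ≤ g k) → 0ℚ ≤ sum g
  sum-nonNeg {zero}  h = ≤-refl
  sum-nonNeg {suc n} h = +-mono-≤ (h zero) (sum-nonNeg (h ∘ suc))

  sum-nonPos : ∀ {n} {g : Fin n → ℚ} → (∀ k → g k ≤ 0ℚ) → sum g ≤ 0ℚ
  sum-nonPos {zero}  h = ≤-refl
  sum-nonPos {suc n} h = +-mono-≤ (h zero) (sum-nonPos (h ∘ suc))

  *-zero-factorˡ : ∀ {p} q → p ≡ 0ℚ → p * q ≡ 0ℚ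
  *-zero-factorˡ q refl = *-zeroˡ q

  *-zero-factorʳ : ∀ p {q} → q ≡ 0ℚ → p * q ≡ 0ℚ
  *-zero-factorʳ p refl = *-zeroʳ p

  ≤0*≤0⇒≥0 : ∀ {p q} → p ≤ 0ℚ → q ≤ 0ℚ → 0ℚ ≤ p * q
  ≤0*≤0⇒≥0 {p} {q} p≤0 q≤0 =
    nonNegative⁻¹ (p * q) {{nonPos*nonPos⇒nonPos p {{nonPositive p≤0}} q {{nonPositive q≤0}}}}

  ≤0*≥0⇒≤0 : ∀ {p q} → p ≤ 0ℚ → 0ℚ ≤ q → p * q ≤ 0ℚ
  ≤0*≥0⇒≤0 {p} {q} p≤0 0≤q =
    nonPositive⁻¹ (p * q) {{nonPos*nonNeg⇒nonPos p {{nonPositive p≤0}} q {{nonNegative 0≤q}}}}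

  -- Degree bounds for polynomials.

  DegreeAtMost : ℕ → PowerSeries → Set
  DegreeAtMost d p = ∀ n → d ℕ.< n → p n ≡ 0ℚ

  const-degree : ∀ c → DegreeAtMost 0 (const c)
  const-degree c (suc n) _ = refl

  t-degree : DegreeAtMost 1 t
  t-degree (suc (suc n)) _       = refl
  t-degree (suc zero)    (s≤s ())

  weaken : ∀ {d e p} → d ℕ.≤ e → DegreeAtMost d p → DegreeAtMost e p
  weaken d≤e h n e<n = h n (ℕₚ.≤-<-trans d≤e e<n)

  ⊕-degree : ∀ {d p q} → DegreeAtMost d p → DegreeAtMost d q → DegreeAtMost d (p ⊕ q)
  ⊕-degree hp hq n d<n = cong₂ _+_ (hp n d<n) (hq n d<n)

  ⊖-degree : ∀ {d p q} → DegreeAtMost d p → DegreeAtMost d q → DegreeAtMost d (p ⊖ q)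
  ⊖-degree hp hq n d<n = cong₂ _-_ (hp n d<n) (hq n d<n)

  ⊛-degree : ∀ {d e p q} → DegreeAtMost d p → DegreeAtMost e q → DegreeAtMost (d ℕ.+ e) (p ⊛ q)
  ⊛-degree {d} {e} {p} {q} hp hq n d+e<n = sum-zero term
    where
    term : ∀ (k : Fin (suc n)) → p (toℕ k) * q (n ∸ toℕ k) ≡ 0ℚ
    term k with d ℕ.<? toℕ k
    ... | yes d<k = *-zero-factorˡ (q (n ∸ toℕ k)) (hp _ d<k)
    -- Here `toℕ k ≤ d`, hence `e < n ∸ d ≤ n ∸ toℕ k`.
    ... | no  d≮k = *-zero-factorʳ (p (toℕ k)) (hq _ (ℕₚ.<-≤-trans
      (ℕₚ.m+n≤o⇒m≤o∸n (suc e) (subst (λ m → suc m ℕ.≤ n) (ℕₚ.+-comm d e) d+e<n))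
      (ℕₚ.∸-monoʳ-≤ n (ℕₚ.≮⇒≥ d≮k))))

  radicand-degree : DegreeAtMost 4 radicand
  radicand-degree = ⊛-degree
    (⊛-degree (⊖-degree 1-degree t-degree)
              (⊖-degree 1-degree (⊛-degree (const-degree (ℤ.+ 2 / 1)) t-degree)))
    (⊕-degree (⊕-degree (⊛-degree (const-degree (ℤ.+ 2 / 1)) (⊛-degree t-degree t-degree))
                        (weaken (s≤s z≤n) t-degree))
              (weaken z≤n (const-degree 1ℚ)))
    where
    1-degree : DegreeAtMost 1 (const 1ℚ)
    1-degree = weaken z≤n (const-degree 1ℚ)

  -- Signs in the square root of the radicand.

  root : PowerSeries
  root = sqrt radicand

  -- Beyond degree 4 the radicand drops out of the recurrence, leaving minus half of a sum of
  -- products of two nonpositive numbers.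
  root-step : ∀ m → let n = 4 ℕ.+ m in
    (∀ k → lookup (sqrtCoeffs radicand n) k ≤ 0ℚ) → root (suc n) ≤ 0ℚ
  root-step m ss≤0 = begin
    ½ * (radicand (5 ℕ.+ m) - S)  ≡⟨ cong (λ r → ½ * (r - S)) (radicand-degree (5 ℕ.+ m) (ℕₚ.m≤m+n 5 m)) ⟩
    ½ * (0ℚ - S)                  ≤⟨ *-monoˡ-≤-nonNeg ½ (+-monoʳ-≤ 0ℚ (neg-antimono-≤ 0≤S)) ⟩
    ½ * (0ℚ - 0ℚ)                 ≡⟨⟩
    0ℚ                            ∎
    where
    open ≤-Reasoning
    ss = sqrtCoeffs radicand (4 ℕ.+ m)
    S = sum (λ k → lookup ss (opposite k) * lookup ss k)
    0≤S : 0ℚ ≤ S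
    0≤S = sum-nonNeg λ k → ≤0*≤0⇒≥0 (ss≤0 (opposite k)) (ss≤0 k)

  -- Speaking of the whole vector makes this a strong induction, as `root-step` requires.
  rootCoeffs-nonPos : ∀ n k → lookup (sqrtCoeffs radicand n) k ≤ 0ℚ
  rootCoeffs-nonPos (suc n) (suc k) = rootCoeffs-nonPos n k
  -- Up to degree 4 the radicand still enters the recurrence, so these signs are found by
  -- evaluation.
  rootCoeffs-nonPos 1 zero = from-yes (root 1 ≤? 0ℚ)
  rootCoeffs-nonPos 2 zero = from-yes (root 2 ≤? 0ℚ)
  rootCoeffs-nonPos 3 zero = from-yes (root 3 ≤? 0ℚ)
  rootCoeffs-nonPos 4 zero = from-yes (root 4 ≤? 0ℚ)
  rootCoeffs-nonPos (suc (suc (suc (suc (suc m))))) zero =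
    root-step m (rootCoeffs-nonPos (suc (suc (suc (suc m)))))

  root-nonPos : ∀ n → root (suc n) ≤ 0ℚ
  root-nonPos n = rootCoeffs-nonPos (suc n) zero

  -- Growth of the coefficients of a reciprocal.

  module _ {p : PowerSeries} (p≤0 : ∀ n → p (suc n) ≤ 0ℚ) where

    invCoeffs-nonNeg : ∀ n k → 0ℚ ≤ lookup (invCoeffs p n) k
    invCoeffs-nonNeg zero    zero    = from-yes (0ℚ ≤? 1ℚ)
    invCoeffs-nonNeg (suc n) (suc k) = invCoeffs-nonNeg n k
    invCoeffs-nonNeg (suc n) zero    = neg-antimono-≤ (sum-nonPos λ k →
      ≤0*≥0⇒≤0 (p≤0 (toℕ k)) (invCoeffs-nonNeg n k))

    -- The term with `p 1` returns the previous coefficient, and the other terms of the recurrence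
    -- can only add to it.
    inv-step : p 1 ≡ - 1ℚ → ∀ n → inv p n ≤ inv p (suc n)
    inv-step p₁ n with invCoeffs p n | invCoeffs-nonNeg n
    ... | i ∷ is | nonNeg = begin
      i                     ≡⟨ ⁻¹-involutive i ⟨
      - (- i)               ≡⟨ cong -_ (+-identityʳ (- i)) ⟨
      - (- i + 0ℚ)          ≤⟨ neg-antimono-≤ (+-monoʳ-≤ (- i) (sum-nonPos λ k →
                                 ≤0*≥0⇒≤0 (p≤0 (suc (toℕ k))) (nonNeg (suc k)))) ⟩
      - (- i + S)           ≡⟨ cong (λ x → - (x + S)) (trans (cong (_* i) p₁) (neg1* i)) ⟨
      - (p 1 * i + S)       ∎
      where
      open ≤-Reasoning
      S = sum (λ k → p (suc (suc (toℕ k))) * lookup is k)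
      neg1* : ∀ i → - 1ℚ * i ≡ - i
      neg1* i = trans (sym (neg-distribˡ-* 1ℚ i)) (cong -_ (*-identityˡ i))

  inv-root≥3 : ∀ n → n ≥ 3 → ℤ.+ 3 / 1 ≤ inv root n
  inv-root≥3 n n≥3 = subst (λ n → ℤ.+ 3 / 1 ≤ inv root n) (ℕₚ.m∸n+n≡m n≥3) (go (n ∸ 3))
    where
    go : ∀ k → ℤ.+ 3 / 1 ≤ inv root (k ℕ.+ 3)
    -- The reciprocal begins 1 + t + t² + 3t³, so this is the first degree where it exceeds 1/(1-t).
    go zero    = from-yes (ℤ.+ 3 / 1 ≤? inv root 3)
    go (suc k) = ≤-trans (go k) (inv-step root-nonPos refl (k ℕ.+ 3))

  inv-1-t : ∀ n → inv (const 1ℚ ⊖ t) n ≡ 1ℚ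
  inv-1-t zero    = refl
  inv-1-t (suc n) with invCoeffs (const 1ℚ ⊖ t) n | inv-1-t n
  ... | i ∷ is | refl = cong (λ s → - (- 1ℚ * 1ℚ + s))
    (sum-zero λ k → *-zeroˡ (lookup is k))

  const-⊛ : ∀ c p n → (const c ⊛ p) n ≡ c * p n
  const-⊛ c p n = trans (cong (_+_ (c * p n)) (sum-zero {n} λ k → *-zeroˡ (p (n ∸ suc (toℕ k))))) (+-identityʳ _)

  coeff-f-pos : ∀ n → n ≥ 3 → coeff n f > 0ℚ
  coeff-f-pos n n≥3 = begin-strict
    0ℚ                                 <⟨ from-yes (0ℚ <? ½ * (ℤ.+ 3 / 1) - ½ * 1ℚ) ⟩
    ½ * (ℤ.+ 3 / 1) - ½ * 1ℚ           ≤⟨ +-monoˡ-≤ (- (½ * 1ℚ)) (*-monoˡ-≤-nonNeg ½ (inv-root≥3 n n≥3)) ⟩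
    ½ * inv root n - ½ * 1ℚ            ≡⟨ cong₂ _-_ (const-⊛ ½ (inv root) n)
                                            (trans (const-⊛ ½ (inv (const 1ℚ ⊖ t)) n)
                                                   (cong (½ *_) (inv-1-t n))) ⟨
    f n                                ∎
    where open ≤-Reasoning

-- Bob's lead in the coin game.

module Game where

  open import Data.Integer.Base using (ℤ; 0ℤ; 1ℤ; -1ℤ; _+_; _*_)
  open import Algebra.Properties.AbelianGroup ℤₚ.+-0-abelianGroup using (∙-cancelʳ)
  open import Algebra.Properties.CommutativeSemigroup ℤₚ.+-commutativeSemigroup using (interchange)
  open import Data.Integer.Tactic.RingSolver using (solve-∀)
  open import Data.List using (List; []; _∷_; _++_; map; filter; length)
  open import Data.List.Properties using (filter-accept; filter-reject)
  open import Data.Vec using (Vec; []; _∷_)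
  open import Relation.Binary.Definitions using (tri<; tri≈; tri>)
  open import Relation.Nullary using (Dec)

  Weight : Set
  Weight = ℕ → ℕ → ℤ

  -- A point already scored is absorbed into the weight, whose first argument is Bob's score; the
  -- recursions on sequences then carry no counters.
  bumpB bumpA : Weight → Weight
  bumpB w b a = w (suc b) a
  bumpA w b a = w b (suc a)

  sgn : Weight
  sgn zero    zero    = 0ℤ
  sgn (suc b) zero    = 1ℤ
  sgn zero    (suc a) = -1ℤ
  sgn (suc b) (suc a) = sgn b a

  eq : Weight
  eq zero    zero    = 1ℤ
  eq (suc b) zero    = 0ℤ
  eq zero    (suc a) = 0ℤ
  eq (suc b) (suc a) = eq b a

  -- When the lead `b - a` moves by one, its sign changes by one exactly if the lead is zero before
  -- or after. This and `sgn-sucˡ` reduce shifts of `sgn` to ties and leads of one point.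
  sgn-sucʳ : ∀ b a → sgn b a ≡ sgn b (suc a) + (eq b a + eq b (suc a))
  sgn-sucʳ zero          zero    = refl
  sgn-sucʳ (suc zero)    zero    = refl
  sgn-sucʳ (suc (suc b)) zero    = refl
  sgn-sucʳ zero          (suc a) = refl
  sgn-sucʳ (suc b)       (suc a) = sgn-sucʳ b a

  sgn-sucˡ : ∀ b a → sgn (suc b) a ≡ sgn b a + (eq b a + eq (suc b) a)
  sgn-sucˡ zero    zero          = refl
  sgn-sucˡ zero    (suc zero)    = refl
  sgn-sucˡ zero    (suc (suc a)) = refl
  sgn-sucˡ (suc b) zero          = refl
  sgn-sucˡ (suc b) (suc a)       = sgn-sucˡ b a

  eq-nonNeg : ∀ b a → 0ℤ ℤ.≤ eq b a
  eq-nonNeg zero    zero    = ℤ.+≤+ z≤n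
  eq-nonNeg (suc b) zero    = ℤ.+≤+ z≤n
  eq-nonNeg zero    (suc a) = ℤ.+≤+ z≤n
  eq-nonNeg (suc b) (suc a) = eq-nonNeg b a

  eq-sym : ∀ b a → eq b a ≡ eq a b
  eq-sym zero    zero    = refl
  eq-sym (suc b) zero    = refl
  eq-sym zero    (suc a) = refl
  eq-sym (suc b) (suc a) = eq-sym b a

  -- This allows an identity valid only on the diagonal, such as `fillings-exchange`, to be used
  -- under a sum over all patterns.
  eq-*-cong : ∀ b a {x y} → (b ≡ a → x ≡ y) → eq b a * x ≡ eq b a * y
  eq-*-cong zero    zero    h = cong (1ℤ *_) (h refl)
  eq-*-cong (suc b) zero    h = refl
  eq-*-cong zero    (suc a) h = refl
  eq-*-cong (suc b) (suc a) h = eq-*-cong b a (λ p → h (cong suc p))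

  -- toH c n w sums w (bobScore (c ∷ x)) (aliceScore (c ∷ x)) over those x of length n
  -- for which c ∷ x ends in H.
  toH : Coin → ℕ → Weight → ℤ
  toH H zero    w = w 0 0
  toH T zero    w = 0ℤ
  toH H (suc n) w = toH H n (bumpA w) + toH T n (bumpB w)
  toH T (suc n) w = toH H n w + toH T n w

  toH-cong : ∀ c n {w v} → (∀ b a → w b a ≡ v b a) → toH c n w ≡ toH c n v
  toH-cong H zero    e = e 0 0
  toH-cong T zero    e = refl
  toH-cong H (suc n) e =
    cong₂ _+_ (toH-cong H n (λ b a → e b (suc a))) (toH-cong T n (λ b a → e (suc b) a))
  toH-cong T (suc n) e = cong₂ _+_ (toH-cong H n e) (toH-cong T n e)

  toH-+ : ∀ c n w v → toH c n (λ b a → w b a + v b a) ≡ toH c n w + toH c n v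
  toH-+ H zero    w v = refl
  toH-+ T zero    w v = refl
  toH-+ H (suc n) w v = trans
    (cong₂ _+_ (toH-+ H n (bumpA w) (bumpA v)) (toH-+ T n (bumpB w) (bumpB v)))
    (interchange (toH H n (bumpA w)) (toH H n (bumpA v)) (toH T n (bumpB w)) (toH T n (bumpB v)))
  toH-+ T (suc n) w v = trans
    (cong₂ _+_ (toH-+ H n w v) (toH-+ T n w v))
    (interchange (toH H n w) (toH H n v) (toH T n w) (toH T n v))

  toH-nonNeg : ∀ c n {w} → (∀ b a → 0ℤ ℤ.≤ w b a) → 0ℤ ℤ.≤ toH c n w
  toH-nonNeg H zero    h = h 0 0
  toH-nonNeg T zero    h = ℤₚ.≤-refl
  toH-nonNeg H (suc n) h =
    ℤₚ.+-mono-≤ (toH-nonNeg H n (λ b a → h b (suc a))) (toH-nonNeg T n (λ b a → h (suc b) a))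
  toH-nonNeg T (suc n) h = ℤₚ.+-mono-≤ (toH-nonNeg H n h) (toH-nonNeg T n h)

  -- Decomposition into blocks.

  -- The sum of g i j over all patterns of at most m blocks, i of kind T…TH and j of kind H.
  patternSum : ℕ → Weight → ℤ
  patternSum zero    g = g 0 0
  patternSum (suc m) g = g 0 0 + (patternSum m (bumpA g) + patternSum m (bumpB g))

  patternSum-cong : ∀ m {g h} → (∀ i j → g i j ≡ h i j) → patternSum m g ≡ patternSum m h
  patternSum-cong zero    e = e 0 0
  patternSum-cong (suc m) e = cong₂ _+_ (e 0 0)
    (cong₂ _+_ (patternSum-cong m (λ i j → e i (suc j))) (patternSum-cong m (λ i j → e (suc i) j)))

  patternSum-+ : ∀ m g h →
    patternSum m (λ i j → g i j + h i j) ≡ patternSum m g + patternSum m h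
  patternSum-+ zero    g h = refl
  patternSum-+ (suc m) g h = trans
    (cong (_+_ (g 0 0 + h 0 0)) (trans
      (cong₂ _+_ (patternSum-+ m (bumpA g) (bumpA h)) (patternSum-+ m (bumpB g) (bumpB h)))
      (interchange (patternSum m (bumpA g)) (patternSum m (bumpA h))
                   (patternSum m (bumpB g)) (patternSum m (bumpB h)))))
    (interchange (g 0 0) (h 0 0) _ _)

  patternSum-zero : ∀ m {g} → (∀ i j → g i j ≡ 0ℤ) → patternSum m g ≡ 0ℤ
  patternSum-zero zero    e = e 0 0
  patternSum-zero (suc m) e = cong₂ _+_ (e 0 0)
    (cong₂ _+_ (patternSum-zero m (λ i j → e i (suc j))) (patternSum-zero m (λ i j → e (suc i) j)))

  patternSum-swap : ∀ m g → patternSum m g ≡ patternSum m (λ i j → g j i)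
  patternSum-swap zero    g = refl
  patternSum-swap (suc m) g = cong (g 0 0 +_) (trans
    (cong₂ _+_ (patternSum-swap m _) (patternSum-swap m _))
    (ℤₚ.+-comm (patternSum m (λ i j → g j (suc i))) _))

  -- fillings i j n is the number of choices of block lengths, adding up to n, in a given
  -- pattern: the coefficient of tⁿ in (t²/(1-t))ⁱ tʲ.  The additional factor t/(1-t) in
  -- fillings⁺ is for the remainder of a block T…TH after its first T.
  fillings fillings⁺ : ℕ → ℕ → ℕ → ℤ
  fillings zero    zero    zero    = 1ℤ
  fillings zero    zero    (suc n) = 0ℤ
  fillings zero    (suc j) zero    = 0ℤ
  fillings zero    (suc j) (suc n) = fillings zero j n
  fillings (suc i) j       zero    = 0ℤ
  fillings (suc i) j       (suc n) = fillings⁺ i j n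
  fillings⁺ i j zero    = 0ℤ
  fillings⁺ i j (suc n) = fillings i j n + fillings⁺ i j n

  fillings-zero : ∀ i j → fillings i (suc j) 0 ≡ 0ℤ
  fillings-zero zero    j = refl
  fillings-zero (suc i) j = refl

  -- `fillings` removes the blocks T...TH first. As the order of factors is immaterial, a block H
  -- can be removed first instead.
  fillings-sucʳ  : ∀ i j n → fillings  i (suc j) (suc n) ≡ fillings  i j n
  fillings⁺-sucʳ : ∀ i j n → fillings⁺ i (suc j) (suc n) ≡ fillings⁺ i j n
  fillings-sucʳ zero    j n       = refl
  fillings-sucʳ (suc i) j zero    = refl
  fillings-sucʳ (suc i) j (suc n) = fillings⁺-sucʳ i j n
  fillings⁺-sucʳ i j zero    = cong (_+ 0ℤ) (fillings-zero i j)
  fillings⁺-sucʳ i j (suc n) = cong₂ _+_ (fillings-sucʳ i j n) (fillings⁺-sucʳ i j n)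

  -- The blocks are read off from left to right, and the scores depend only on how many there are of
  -- each kind. Every block has positive length, so any bound `m ≥ n` suffices; this freedom lets
  -- lengths `n` and `suc n` be compared over the same patterns.
  toH-H-patternSum : ∀ m n w → n ℕ.≤ m →
    toH H n w ≡ patternSum m (λ i j → w i j * fillings i j n)
  toH-T-patternSum : ∀ m n w → n ℕ.≤ m →
    toH T n w ≡ patternSum m (λ i j → w i j * fillings⁺ i j n)
  toH-H-patternSum zero    zero w _ = sym (ℤₚ.*-identityʳ (w 0 0))
  toH-H-patternSum (suc m) zero w _ = sym (trans
    (cong₂ _+_ (ℤₚ.*-identityʳ (w 0 0)) (cong₂ _+_
      (patternSum-zero m (λ i j → trans (cong (_*_ (w i (suc j))) (fillings-zero i j)) (ℤₚ.*-zeroʳ (w i (suc j)))))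
      (patternSum-zero m (λ i j → ℤₚ.*-zeroʳ (w (suc i) j)))))
    (ℤₚ.+-identityʳ (w 0 0)))
  toH-H-patternSum (suc m) (suc n) w (s≤s n≤m) = sym (trans
    (cong₂ _+_ (ℤₚ.*-zeroʳ (w 0 0)) (cong₂ _+_
      (trans (patternSum-cong m (λ i j → cong (w i (suc j) *_) (fillings-sucʳ i j n)))
             (sym (toH-H-patternSum m n _ n≤m)))
      (sym (toH-T-patternSum m n _ n≤m))))
    (ℤₚ.+-identityˡ _))
  toH-T-patternSum m zero    w _   = sym (patternSum-zero m (λ i j → ℤₚ.*-zeroʳ (w i j)))
  toH-T-patternSum m (suc n) w n<m = sym (trans
    (patternSum-cong m (λ i j → ℤₚ.*-distribˡ-+ (w i j) (fillings i j n) (fillings⁺ i j n)))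
    (trans (patternSum-+ m _ _)
      (sym (cong₂ _+_ (toH-H-patternSum m n w (ℕₚ.<⇒≤ n<m)) (toH-T-patternSum m n w (ℕₚ.<⇒≤ n<m))))))

  -- Giving Alice one more point produces a tie exactly when Bob leads by one, whence `bumpA eq` for
  -- `bobByOne`.
  tied bobByOne aliceByOne : ℕ → ℤ
  tied       n = toH H n eq
  bobByOne   n = toH H n (bumpA eq)
  aliceByOne n = toH H n (bumpB eq)

  -- (1-t) (t²/(1-t))ʲ⁺¹ tʲ = t (t²/(1-t))ʲ tʲ⁺¹
  fillings-exchange : ∀ j n →
    fillings (suc j) j (suc n) ≡ fillings (suc j) j n + fillings j (suc j) n
  fillings-exchange j zero    = sym (trans (ℤₚ.+-identityˡ _) (fillings-zero j j))
  fillings-exchange j (suc n) = trans (ℤₚ.+-comm (fillings j j n) _)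
    (cong (fillings⁺ j j n +_) (sym (fillings-sucʳ j j n)))

  -- Interchanging the two kinds of blocks in a pattern exchanges Bob's and Alice's lead.
  bobByOne-suc : ∀ n → bobByOne (suc n) ≡ bobByOne n + aliceByOne n
  bobByOne-suc n = begin
    bobByOne (suc n)
      ≡⟨ toH-H-patternSum (suc n) (suc n) (bumpA eq) ℕₚ.≤-refl ⟩
    patternSum (suc n) (λ i j → eq i (suc j) * fillings i j (suc n))
      ≡⟨ patternSum-cong (suc n) exchange ⟩
    patternSum (suc n) (λ i j → bob i j + alice j i)
      ≡⟨ patternSum-+ (suc n) bob (λ i j → alice j i) ⟩
    patternSum (suc n) bob + patternSum (suc n) (λ i j → alice j i)
      ≡⟨ cong (_+_ (patternSum (suc n) bob)) (patternSum-swap (suc n) alice) ⟨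
    patternSum (suc n) bob + patternSum (suc n) alice
      ≡⟨ cong₂ _+_ (toH-H-patternSum (suc n) n (bumpA eq) (ℕₚ.n≤1+n n))
                   (toH-H-patternSum (suc n) n (bumpB eq) (ℕₚ.n≤1+n n)) ⟨
    bobByOne n + aliceByOne n ∎
    where
    open ≡-Reasoning
    bob alice : Weight
    bob   i j = eq i (suc j) * fillings i j n
    alice i j = eq (suc i) j * fillings i j n
    exchange : ∀ i j → eq i (suc j) * fillings i j (suc n) ≡ bob i j + alice j i
    -- The factor `eq` forces `i = suc j`, where `fillings-exchange` applies; `eq-sym` recovers the
    -- weight of `alice` with its arguments swapped.
    exchange i j = trans (eq-*-cong i (suc j) λ { refl → fillings-exchange j n })
      (trans (ℤₚ.*-distribˡ-+ (eq i (suc j)) _ _)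
        (cong (λ k → eq i (suc j) * fillings i j n + k * fillings j i n) (eq-sym i (suc j))))

  -- Signed count of the sequences ending in H.

  signedToH : ℕ → ℤ
  signedToH n = toH H n sgn

  signed-alice-step : ∀ n → signedToH n ≡ toH H n (bumpA sgn) + (tied n + bobByOne n)
  signed-alice-step n = trans (toH-cong H n sgn-sucʳ)
    (trans (toH-+ H n _ _) (cong (toH H n (bumpA sgn) +_) (toH-+ H n _ _)))

  signed-bob-step : ∀ n → toH H n (bumpB sgn) ≡ signedToH n + (tied n + aliceByOne n)
  signed-bob-step n = trans (toH-cong H n sgn-sucˡ)
    (trans (toH-+ H n _ _) (cong (signedToH n +_) (toH-+ H n _ _)))

  -- The left-hand side doubles from n to n + 1, because bobByOne-suc cancels the other terms.
  signedToH-suc : ∀ n → signedToH (suc n) + tied n ≡ 0ℤ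
  signedToH-suc zero    = refl
  signedToH-suc (suc n) = begin
    -- This is `signedToH (suc (suc n))` unfolded; below, `y + v` is `signedToH (suc n)` unfolded.
    (x + (toH H n (bumpB sgn) + v)) + tied (suc n)
      ≡⟨ cong (λ k → (x + (k + v)) + tied (suc n)) (signed-bob-step n) ⟩
    (x + (q + (tied n + aliceByOne n) + v)) + tied (suc n)
      ≡⟨ cong (λ k → (x + (k + (tied n + aliceByOne n) + v)) + tied (suc n)) (signed-alice-step n) ⟩
    (x + (y + (tied n + bobByOne n) + (tied n + aliceByOne n) + v)) + tied (suc n)
      ≡⟨ regroup x y (tied n) (bobByOne n) (aliceByOne n) v (tied (suc n)) ⟩
    (x + (tied (suc n) + (bobByOne n + aliceByOne n))) + (((y + v) + tied n) + tied n)
      ≡⟨ cong (λ k → (x + (tied (suc n) + k)) + ((signedToH (suc n) + tied n) + tied n)) (sym (bobByOne-suc n)) ⟩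
    (x + (tied (suc n) + bobByOne (suc n))) + ((signedToH (suc n) + tied n) + tied n)
      ≡⟨ cong₂ (λ k l → k + (l + tied n)) (sym (signed-alice-step (suc n))) (signedToH-suc n) ⟩
    signedToH (suc n) + (0ℤ + tied n)
      ≡⟨ cong (signedToH (suc n) +_) (ℤₚ.+-identityˡ (tied n)) ⟩
    signedToH (suc n) + tied n
      ≡⟨ signedToH-suc n ⟩
    0ℤ ∎
    where
    open ≡-Reasoning
    q = signedToH n
    x = toH H (suc n) (bumpA sgn)
    y = toH H n (bumpA sgn)
    v = toH T n (bumpB sgn)
    regroup : ∀ x y c d e v f →
      (x + (y + (c + d) + (c + e) + v)) + f
        ≡ (x + (f + (d + e))) + (((y + v) + c) + c)
    regroup = solve-∀

  -- Sums over all sequences.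

  listSum : {A : Set} → (A → ℤ) → List A → ℤ
  listSum g []       = 0ℤ
  listSum g (x ∷ xs) = g x + listSum g xs

  listSum-++ : {A : Set} (g : A → ℤ) (xs ys : List A) →
    listSum g (xs ++ ys) ≡ listSum g xs + listSum g ys
  listSum-++ g []       ys = sym (ℤₚ.+-identityˡ _)
  listSum-++ g (x ∷ xs) ys = trans (cong (g x +_) (listSum-++ g xs ys)) (sym (ℤₚ.+-assoc (g x) _ _))

  listSum-map : {A B : Set} (g : B → ℤ) (h : A → B) (xs : List A) →
    listSum g (map h xs) ≡ listSum (λ x → g (h x)) xs
  listSum-map g h []       = refl
  listSum-map g h (x ∷ xs) = cong (g (h x) +_) (listSum-map g h xs)

  listSum-outcomes-suc : ∀ n (g : Vec Coin (suc n) → ℤ) → listSum g (outcomes (suc n)) ≡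
    listSum (λ x → g (H ∷ x)) (outcomes n) + listSum (λ x → g (T ∷ x)) (outcomes n)
  listSum-outcomes-suc n g = begin
    listSum g (map (H ∷_) xs ++ map (T ∷_) xs ++ [])
      ≡⟨ listSum-++ g (map (H ∷_) xs) _ ⟩
    listSum g (map (H ∷_) xs) + listSum g (map (T ∷_) xs ++ [])
      ≡⟨ cong (listSum g (map (H ∷_) xs) +_) (trans (listSum-++ g (map (T ∷_) xs) []) (ℤₚ.+-identityʳ _)) ⟩
    listSum g (map (H ∷_) xs) + listSum g (map (T ∷_) xs)
      ≡⟨ cong₂ _+_ (listSum-map g (H ∷_) xs) (listSum-map g (T ∷_) xs) ⟩
    listSum (λ x → g (H ∷ x)) xs + listSum (λ x → g (T ∷ x)) xs ∎
    where
    open ≡-Reasoning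
    xs = outcomes n

  total : Coin → ℕ → Weight → ℤ
  total c n w = listSum (λ x → w (bobScore (c ∷ x)) (aliceScore (c ∷ x))) (outcomes n)

  -- Appending H to a sequence scores for Alice exactly if the sequence already ended in H.
  total-toH : ∀ c n w →
    total c n w + toH c n (bumpA w) ≡ toH c n w + toH c (suc n) w
  total-toH H zero w = lemma (w 0 0) (w 0 1)
    where
    lemma : ∀ x y → x + 0ℤ + y ≡ x + (y + 0ℤ)
    lemma = solve-∀
  total-toH T zero w = lemma (w 0 0)
    where
    lemma : ∀ x → x + 0ℤ + 0ℤ ≡ 0ℤ + (x + 0ℤ)
    lemma = solve-∀
  total-toH H (suc n) w = begin
    total H (suc n) w + toH H (suc n) (bumpA w)
      ≡⟨ cong (_+ toH H (suc n) (bumpA w)) (listSum-outcomes-suc n _) ⟩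
    (total H n (bumpA w) + total T n (bumpB w)) + toH H (suc n) (bumpA w)
      ≡⟨ interchange (total H n (bumpA w)) (total T n (bumpB w)) _ _ ⟩
    _ ≡⟨ cong₂ _+_ (total-toH H n (bumpA w)) (total-toH T n (bumpB w)) ⟩
    _ ≡⟨ interchange (toH H n (bumpA w)) (toH H (suc n) (bumpA w)) _ _ ⟩
    toH H (suc n) w + toH H (suc (suc n)) w ∎
    where open ≡-Reasoning
  total-toH T (suc n) w = begin
    total T (suc n) w + toH T (suc n) (bumpA w)
      ≡⟨ cong (_+ toH T (suc n) (bumpA w)) (listSum-outcomes-suc n _) ⟩
    (total H n w + total T n w) + toH T (suc n) (bumpA w)
      ≡⟨ interchange (total H n w) (total T n w) _ _ ⟩
    _ ≡⟨ cong₂ _+_ (total-toH H n w) (total-toH T n w) ⟩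
    _ ≡⟨ interchange (toH H n w) (toH H (suc n) w) _ _ ⟩
    toH T (suc n) w + toH T (suc (suc n)) w ∎
    where open ≡-Reasoning

  -- In `total-toH` for `sgn`, the ties produced by `signed-alice-step` cancel against
  -- `signedToH (suc n)`, and only `bobByOne n` remains.
  total-H-sgn : ∀ n → total H n sgn ≡ bobByOne n
  total-H-sgn n = ∙-cancelʳ (toH H n (bumpA sgn)) _ _ (begin
    total H n sgn + y                                      ≡⟨ total-toH H n sgn ⟩
    signedToH n + signedToH (suc n)                        ≡⟨ cong (_+ signedToH (suc n)) (signed-alice-step n) ⟩
    y + (tied n + bobByOne n) + signedToH (suc n)          ≡⟨ regroup y (tied n) (bobByOne n) _ ⟩
    bobByOne n + y + (signedToH (suc n) + tied n)          ≡⟨ cong (bobByOne n + y +_) (signedToH-suc n) ⟩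
    bobByOne n + y + 0ℤ                                    ≡⟨ ℤₚ.+-identityʳ _ ⟩
    bobByOne n + y                                         ∎)
    where
    open ≡-Reasoning
    y = toH H n (bumpA sgn)
    regroup : ∀ y c d q → y + (c + d) + q ≡ d + y + (q + c)
    regroup = solve-∀

  -- From Bob's advantage to probabilities.

  margin : ∀ {n} → Vec Coin n → ℤ
  margin x = sgn (bobScore x) (aliceScore x)

  -- This is `2 ^ n` times `Δ n`, kept as an integer.
  advantage : ℕ → ℤ
  advantage n = listSum margin (outcomes n)

  listSum-cong : {A : Set} {g h : A → ℤ} → (∀ x → g x ≡ h x) → ∀ xs → listSum g xs ≡ listSum h xs
  listSum-cong e []       = refl
  listSum-cong e (x ∷ xs) = cong₂ _+_ (e x) (listSum-cong e xs)

  total-T : ∀ n w → total T n w ≡ listSum (λ x → w (bobScore x) (aliceScore x)) (outcomes n)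
  total-T n w = listSum-cong (λ x → cong₂ w (bob x) (alice x)) (outcomes n)
    where
    bob : ∀ {n} (x : Vec Coin n) → bobScore (T ∷ x) ≡ bobScore x
    bob []      = refl
    bob (_ ∷ _) = refl
    alice : ∀ {n} (x : Vec Coin n) → aliceScore (T ∷ x) ≡ aliceScore x
    alice []      = refl
    alice (_ ∷ _) = refl

  advantage-suc : ∀ n → advantage (suc n) ≡ bobByOne n + advantage n
  advantage-suc n = trans (listSum-outcomes-suc n _) (cong₂ _+_ (total-H-sgn n) (total-T n sgn))

  advantage-pos : ∀ n → n ≥ 3 → 0ℤ ℤ.< advantage n
  advantage-pos n n≥3 = subst (λ n → 0ℤ ℤ.< advantage n) (ℕₚ.m∸n+n≡m n≥3) (go (n ∸ 3))
    where
    go : ∀ k → 0ℤ ℤ.< advantage (k ℕ.+ 3)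
    -- `advantage 3` evaluates to 1: three wins for Bob against two for Alice.
    go zero    = ℤ.+<+ (s≤s z≤n)
    go (suc k) = subst (0ℤ ℤ.<_) (sym (advantage-suc (k ℕ.+ 3)))
      (ℤₚ.+-mono-≤-< (toH-nonNeg H (k ℕ.+ 3) (λ b a → eq-nonNeg b (suc a))) (go k))

  sgn-< : ∀ {b a} → a ℕ.< b → sgn b a ≡ 1ℤ
  sgn-< {suc b} {zero}  _       = refl
  sgn-< {suc b} {suc a} (s≤s p) = sgn-< p

  sgn-> : ∀ {b a} → b ℕ.< a → sgn b a ≡ -1ℤ
  sgn-> {zero}  {suc a} _       = refl
  sgn-> {suc b} {suc a} (s≤s p) = sgn-> p

  sgn-refl : ∀ b → sgn b b ≡ 0ℤ
  sgn-refl zero    = refl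
  sgn-refl (suc b) = sgn-refl b

  bob?   : ∀ {n} (x : Vec Coin n) → Dec (aliceScore x ℕ.< bobScore x)
  alice? : ∀ {n} (x : Vec Coin n) → Dec (bobScore x ℕ.< aliceScore x)
  bob?   x = aliceScore x ℕ.<? bobScore x
  alice? x = bobScore x ℕ.<? aliceScore x

  bobWins-aliceWins : ∀ {n} (xs : List (Vec Coin n)) →
    ℤ.+ length (filter bob? xs) ≡ listSum margin xs + ℤ.+ length (filter alice? xs)
  bobWins-aliceWins []       = refl
  bobWins-aliceWins (x ∷ xs) with ℕₚ.<-cmp (aliceScore x) (bobScore x)
  ... | tri< a<b _ b≮a
    rewrite filter-accept bob? {x} {xs} a<b | filter-reject alice? {x} {xs} b≮a | sgn-< a<b =
    trans (cong (_+_ 1ℤ) (bobWins-aliceWins xs))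
          (sym (ℤₚ.+-assoc 1ℤ (listSum margin xs) (ℤ.+ length (filter alice? xs))))
  ... | tri≈ a≮b a≡b b≮a
    rewrite filter-reject bob? {x} {xs} a≮b | filter-reject alice? {x} {xs} b≮a
          | a≡b | sgn-refl (bobScore x) =
    trans (bobWins-aliceWins xs)
          (cong (_+ ℤ.+ length (filter alice? xs)) (sym (ℤₚ.+-identityˡ (listSum margin xs))))
  ... | tri> a≮b _ b<a
    rewrite filter-reject bob? {x} {xs} a≮b | filter-accept alice? {x} {xs} b<a | sgn-> b<a =
    trans (bobWins-aliceWins xs) (insert (listSum margin xs) (ℤ.+ length (filter alice? xs)))
    where
    insert : ∀ x y → x + y ≡ -1ℤ + x + (1ℤ + y)
    insert = solve-∀

  -- Both probabilities have denominator `2 ^ n`, and their numerators differ by `advantage n`.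
  bob-likelier : ∀ n → n ≥ 3 → P-Bob n > P-Alice n
  bob-likelier n n≥3 = Series./-mono-< {ℤ.+ q} {ℤ.+ p} (2 ^ n) {{ℕₚ.m^n≢0 2 n}}
    (subst₂ ℤ._<_ (ℤₚ.+-identityˡ (ℤ.+ q)) (sym (bobWins-aliceWins (outcomes n)))
      (ℤₚ.+-monoˡ-< (ℤ.+ q) (advantage-pos n n≥3)))
    where
    p = length (filter bob? (outcomes n))
    q = length (filter alice? (outcomes n))

mainTheorem3 : (∀ (n : ℕ) → n ≥ 3 → (Δ n > 0ℚ) × (P-Bob n > P-Alice n))
    × (∀ (n : ℕ) → n ≥ 3 → coeff n f > 0ℚ)
mainTheorem3 =
  (λ n n≥3 → Series.p<q⇒0<q-p (Game.bob-likelier n n≥3) , Game.bob-likelier n n≥3) ,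
  Series.coeff-f-pos
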